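{- Let $x$ be a nonempty modified ascent sequence, and let $\mathrm{flip}(x)$ denote the modified ascent sequence that corresponds to the Fishburn matrix $\mathrm{flip}(A)$, where $A=(\beta\circ\bar\alpha)(x)$; that is, $\mathrm{flip}(x)$ is the modified ascent sequence with $(\beta\circ\bar\alpha)(\mathrm{flip}(x))=\mathrm{flip}(A)$. Then $$\mathrm{flip}(x)=\alpha\bigl(\mathrm{flip}(\mathfrak{P}(x))\bigr),$$ where $\alpha$ is the map from Fishburn covers to modified ascent sequences given by the block-insertion procedure.
   Context: Write $[k]=\{1,\dots,k\}$. Trees. A binary tree is either empty or a triple $T=(L,r,R)$ with $r$ a node (the root) and $L,R$ binary trees. $V(T)$ is the set of nodes and the size of $T$ is $|V(T)|$. A vertex labeling is a map $\mathfrak{l}:V(T)\to\{1,2,\dots\}$; $\max(T)$ is the largest label, $\max(\emptyset)=0$. Labeled trees are considered up to label-preserving isomorphism. $T$ is decreasing if it is empty, or $L,R$ are decreasing and $\mathfrak{l}(r)\ge\max\{\max(L),\max(R)\}$; strictly decreasing to the left if it is empty, or $\mathfrak{l}(r)>\max(L)$ and $L,R$ are strictly decreasing to the left. An endotree of size $n$ is a decreasing binary tree of size $n$ that is strictly decreasing to the left with all labels in $[n]$; it is regular if its label set is $[k]$ for some $k\le n$. Let $v_i$ be the $i$-th node visited in the in-order traversal (left subtree, root, right subtree). $\mathrm{asctops}(T)=\{v_1\}\cup\{v_i:v_i\text{ has a left child}\}$, $\mathrm{nub}(T)=\{v_j:\mathfrak{l}(v_i)\ne\mathfrak{l}(v_j)\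 \forall i<j\}$. A Fishburn tree is a regular endotree with $\mathrm{nub}(T)=\mathrm{asctops}(T)$. Paths and covers. A maximal right path is a nonempty sequence of nodes, each the right child of the previous one, whose first node is not a right child and whose last node has no right child; maximal left paths are analogous. $\mathrm{rpath}(v)$ is the maximal right path containing $v$; $\mathrm{diag}(T)$ is the maximal left path containing the root. For a Fishburn tree $T$ with $k=\max(T)$, $\mathrm{asctops}(T)$ has exactly one node of each label $i\in[k]$; if $v$ is that node, $W_i=\mathrm{rpath}(v)$ if $v\in\mathrm{diag}(T)$ and $W_i=\mathrm{rpath}(\text{left child of }v)$ otherwise. Let $B_i$ be the multiset of labels of nodes of $W_i$ and $\mathfrak{P}(T)=B_1\dots B_k$. This is a Fishburn cover, i.e. a list of $k$ nonempty multisets whose elements form exactly the set $[k]$ and such that $j\in B_i$ implies $j\le i$. Sequences. A Cayley permutation is a word $x=x_1\dots x_n$ whose set of values is $[k]$ for some $k$. A modified ascent sequence is a Cayley permutation $x$ with $\mathrm{asctops}(x)=\mathrm{nub}(x)$, where $\mathrm{asctops}(x)=\{(1,x_1)\}\cup\{(i,x_i):1<i\le n,\,x_{i-1}<x_i\}$ and $\mathrm{nub}(x)=\{(\min x^{ -1}(j),j):1\le j\le\max(x)\}$. For a word $x$ of positive integers, $\bar\alpha(x)$ is the empty tree if $x$ is empty; otherwise, with $m$ the index of the leftmost maximum of $x$, $\bar\alpha(x)$ has root labeled $x_m$, left subtree $\bar\alpha(x_1\dots x_{m-1})$ and right subtree $\bar\alpha(x_{m+1}\dots x_n)$. It restricts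 to a bijection from modified ascent sequences to Fishburn trees, whose inverse is the in-order sequence. Put $\mathfrak{P}(x)=\mathfrak{P}(\bar\alpha(x))$. Matrices. A Fishburn matrix is a lower triangular square matrix with nonnegative integer entries and no zero row or column. For a Fishburn tree $T$ with $k=\max(T)$, $\beta(T)$ is the $k\times k$ matrix whose $(i,j)$-entry is the number of nodes with label $j$ in $W_i$; $\beta$ is a bijection from Fishburn trees to Fishburn matrices. For a $k\times k$ matrix $A=(a_{i,j})$, $\mathrm{flip}(A)(i,j)=a_{k+1-j,k+1-i}$; the flip of a Fishburn matrix is a Fishburn matrix. Flip of covers. A Fishburn cover $P=B_1\dots B_k$ is identified with the multiset of columns $\binom{i}{j}$, one for each $j\in B_i$ (with multiplicity). $\mathrm{flip}(P)$ is the cover obtained by replacing each column $\binom{i}{j}$ with $\binom{k+1-j}{k+1-i}$. The map $\alpha$ on covers (block-insertion procedure). Let $P=B_1\dots B_k$ be a Fishburn cover and let $\overrightarrow{B_i}$ be the word listing the elements of $B_i$ in weakly decreasing order. Let $\{i\in[k]:i\in B_i\}=\{i_1<\dots<i_p\}$ and $\{i\in[k]:i\notin B_i\}=\{j_1>\dots>j_q\}$. Let $x^{(0)}=\overrightarrow{B_{i_1}}\,\overrightarrow{B_{i_2}}\dots\overrightarrow{B_{i_p}}$ (concatenation), and for $s=1,\dots,q$ let $x^{(s)}$ be obtained from $x^{(s-1)}$ by inserting $\overrightarrow{B_{j_s}}$ immediately before the leftmost occurrence of the integer $j_s$. Then $\alpha(P)=x^{(q)}$. -}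

module Defs where

open import Data.Bool using (Bool; true; false; if_then_else_)
open import Data.Fin using (Fin; toℕ; opposite)
open import Data.List using (List; []; _∷_; _++_; map; concatMap; filter; foldl; foldr; head; length; reverse; span; upTo; zip)
open import Data.List.Membership.Propositional using (_∈_)
open import Data.List.Membership.DecPropositional using () renaming (_∈?_ to member?)
import Data.List.Sort.InsertionSort as InsertionSort
open import Data.Maybe using (Maybe; just; nothing; maybe′)
import Data.Maybe as Maybe
open import Data.Maybe.Relation.Unary.Any using (dec)
open import Data.Nat using (ℕ; zero; suc; _+_; _∸_; _⊔_; _≤_; _<_; _≟_; _<?_)
open import Data.Nat.Properties using (≤-decTotalOrder)
open import Data.Product using (Σ; ∃; _×_; _,_; proj₁; proj₂)
open import Data.Sum using (_⊎_)
open import Data.Tree.Binary using (Tree; leaf; node)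
open import Data.Unit using (⊤; tt)
open import Data.Vec using (Vec; lookup; tabulate)
open import Function using (_∘_; _⇔_)
open import Level using (0ℓ)
open import Relation.Binary.Construct.Flip.EqAndOrd using (decTotalOrder)
open import Relation.Binary.PropositionalEquality using (_≡_)
open import Relation.Nullary using (Dec; yes; no; ¬?)
open import Relation.Unary using (Pred; _≐_)

------------------------------------------------------------------------
-- Words and modified ascent sequences

Word : Set
Word = List ℕ

max : Word → ℕ
max = foldr _⊔_ 0

[1⋯_] : ℕ → List ℕ
[1⋯ k ] = map suc (upTo k)

-- "x at i is a" means x_i = a; positions are counted from 1.
data _at_is_ : Word → ℕ → ℕ → Set where
  here  : ∀ {a x} → (a ∷ x) at 1 is a
  there : ∀ {a b x i} → x at i is a → (b ∷ x) at suc i is a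

IsCayley : Word → Set
IsCayley x = ∃ λ k → ∀ j → j ∈ x ⇔ (1 ≤ j × j ≤ k)

asctops : Word → Pred (ℕ × ℕ) 0ℓ
asctops x (i , a) =
  x at i is a × (i ≡ 1 ⊎ (∃ λ h → ∃ λ b → i ≡ suc h × x at h is b × b < a))

nub : Word → Pred (ℕ × ℕ) 0ℓ
nub x (i , j) =
  (1 ≤ j × j ≤ max x) × (x at i is j × (∀ h → x at h is j → i ≤ h))

IsModifiedAscentSequence : Word → Set
IsModifiedAscentSequence x = IsCayley x × asctops x ≐ nub x

------------------------------------------------------------------------
-- Labeled binary trees

-- An inductive type, so propositional equality of trees is
-- label-preserving isomorphism.
BinTree : Set
BinTree = Tree ℕ ⊤

maxT : BinTree → ℕ
maxT (leaf _)     = 0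
maxT (node l a r) = a ⊔ (maxT l ⊔ maxT r)

-- The first component of the span is the longest prefix of letters below
-- the maximum, so the letter that follows it is the leftmost maximum.
-- The first argument of ᾱ-fuel only bounds the recursion depth; any number
-- that is at least the length of the word gives the same tree.
ᾱ-fuel : ℕ → Word → BinTree
ᾱ-fuel zero    _ = leaf tt
ᾱ-fuel (suc n) x with span (_<? max x) x
... | _ , []    = leaf tt
... | u , m ∷ w = node (ᾱ-fuel n u) m (ᾱ-fuel n w)

ᾱ : Word → BinTree
ᾱ x = ᾱ-fuel (length x) x

-- V(T): a node is addressed by the path leading to it from the root.
data Node : BinTree → Set where
  root : ∀ {l a r} → Node (node l a r)
  inˡ  : ∀ {l a r} → Node l → Node (node l a r)
  inʳ  : ∀ {l a r} → Node r → Node (node l a r)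

label : ∀ {t} → Node t → ℕ
label (root {a = a}) = a
label (inˡ v)        = label v
label (inʳ v)        = label v

rootOf : ∀ t → Maybe (Node t)
rootOf (leaf _)     = nothing
rootOf (node _ _ _) = just root

leftChild : ∀ {t} → Node t → Maybe (Node t)
leftChild (root {l = l}) = Maybe.map inˡ (rootOf l)
leftChild (inˡ v)        = Maybe.map inˡ (leftChild v)
leftChild (inʳ v)        = Maybe.map inʳ (leftChild v)

hasLeftChild? : ∀ {t} (v : Node t) → Dec (Maybe.Is-just (leftChild v))
hasLeftChild? v = dec (λ _ → yes tt) (leftChild v)

inorder : ∀ t → List (Node t)
inorder (leaf _)     = []
inorder (node l _ r) = map inˡ (inorder l) ++ root ∷ map inʳ (inorder r)

-- The first node of the in-order traversal never has a left child, so this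
-- lists every element of the set asctops(T) exactly once.
asctopsT : ∀ t → List (Node t)
asctopsT t with inorder t
... | []     = []
... | v ∷ vs = v ∷ filter hasLeftChild? vs

-- diag(T), the maximal left path containing the root, consists of the
-- nodes reached from the root by left steps only.
inDiag : ∀ {t} → Node t → Bool
inDiag root    = true
inDiag (inˡ v) = inDiag v
inDiag (inʳ _) = false

-- Membership in the maximal right path that contains the root.
onRootRightPath : ∀ {t} → Node t → Bool
onRootRightPath root    = true
onRootRightPath (inˡ _) = false
onRootRightPath (inʳ v) = onRootRightPath v

rootRightPath : ∀ t → List (Node t)
rootRightPath (leaf _)     = []
rootRightPath (node _ _ r) = root ∷ map inʳ (rootRightPath r)

-- rpath(v), listed from its first (topmost) node to its last.  In the case
-- inʳ v, if v lies on the right path of the root of the right subtree then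
-- that path is extended upwards by the root.
rpath : ∀ {t} → Node t → List (Node t)
rpath {t} root    = rootRightPath t
rpath     (inˡ v) = map inˡ (rpath v)
rpath {t} (inʳ v) =
  if onRootRightPath v then rootRightPath t else map inʳ (rpath v)

-- A node of asctops(T) that is not on diag(T) has a left child, so the
-- default [] is not reached for such nodes.
pathOf : ∀ {t} → Node t → List (Node t)
pathOf v = if inDiag v then rpath v else maybe′ rpath [] (leftChild v)

-- W_i.  For a Fishburn tree and 1 ≤ i ≤ max(T) the filtered list has
-- exactly one element; the value is immaterial otherwise.
W : ∀ t → ℕ → List (Node t)
W t i = maybe′ pathOf [] (head (filter (λ v → label v ≟ i) (asctopsT t)))

------------------------------------------------------------------------
-- Fishburn matrices

SquareMatrix : Set
SquareMatrix = Σ ℕ λ k → Vec (Vec ℕ k) k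

-- The indices i, j : Fin k stand for the row and column suc (toℕ i) and
-- suc (toℕ j).
β : BinTree → SquareMatrix
β t = maxT t , tabulate λ i → tabulate λ j →
  length (filter (λ v → label v ≟ suc (toℕ j)) (W t (suc (toℕ i))))

-- opposite is the reversal i ↦ k + 1 - i of the (1-based) indices.
flipMatrix : SquareMatrix → SquareMatrix
flipMatrix (k , A) = k , tabulate λ i → tabulate λ j →
  lookup (lookup A (opposite j)) (opposite i)

------------------------------------------------------------------------
-- Fishburn covers

-- A finite multiset is represented by a list of its elements in any order;
-- α does not depend on the chosen order.
Multiset : Set
Multiset = List ℕ

-- The i-th entry of the list, counting from 1, is B_i.
Cover : Set
Cover = List Multiset

𝔓 : BinTree → Cover
𝔓 t = map (λ i → map label (W t i)) [1⋯ maxT t ]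

indexed : Cover → List (ℕ × Multiset)
indexed P = zip [1⋯ length P ] P

columns : Cover → List (ℕ × ℕ)
columns P = concatMap (λ (i , B) → map (i ,_) B) (indexed P)

fromColumns : ℕ → List (ℕ × ℕ) → Cover
fromColumns k cs = map (λ i → map proj₂ (filter (λ c → proj₁ c ≟ i) cs)) [1⋯ k ]

flipCover : Cover → Cover
flipCover P = fromColumns k (map (λ (i , j) → (k + 1 ∸ j , k + 1 ∸ i)) (columns P))
  where k = length P

decreasing : Multiset → Word
decreasing = InsertionSort.sort (decTotalOrder ≤-decTotalOrder)

-- insertBefore j w x inserts w immediately before the leftmost j in x; if
-- j does not occur in x (impossible for Fishburn covers), x is unchanged.
insertBefore : ℕ → Word → Word → Word
insertBefore j w []      = []
insertBefore j w (a ∷ x) with a ≟ j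
... | yes _ = w ++ a ∷ x
... | no  _ = a ∷ insertBefore j w x

ownBlock? : (iB : ℕ × Multiset) → Dec (proj₁ iB ∈ proj₂ iB)
ownBlock? (i , B) = member? _≟_ i B

α : Cover → Word
α P = foldl (λ x (j , B) → insertBefore j (decreasing B) x) x⁰ js
  where
  x⁰ : Word
  x⁰ = concatMap (decreasing ∘ proj₂) (filter ownBlock? (indexed P))

  js : List (ℕ × Multiset)
  js = reverse (filter (¬? ∘ ownBlock?) (indexed P))

{-# OPTIONS --safe #-}

-- By the correspondence of matrix entries and block multiplicities, the blocks of
-- flip(𝔓(x)) are permutations of those of 𝔓(y), so it suffices that α recovers y
-- from 𝔓(y).  The modified ascent condition says that the node of ᾱ(y) labeled j
-- with a left child (or on the diagonal) carries the first j of the in-order word.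
-- Concatenating the right paths that meet the diagonal therefore gives the
-- in-order word of ᾱ(y) with all other left subtrees deleted, and inserting W_j for
-- decreasing j restores the left subtree of the node labeled j, down to its right
-- path, in the correct place.

module Submission where

open import Defs
open import Data.Bool using (true; false; if_then_else_)
open import Data.Fin using (Fin; toℕ; fromℕ<; opposite)
open import Data.Fin.Properties using (toℕ-injective; toℕ-fromℕ<; toℕ<n; opposite-prop)
open import Data.List using (List; []; _∷_; _++_; _ʳ++_; applyUpTo; concatMap; filter; foldl; foldr; head; length; map; reverse; span; upTo; zip)
open import Data.List.Membership.Propositional using (_∈_; _∉_)
open import Data.List.Membership.Propositional.Properties using (∈-++⁺ˡ; ∈-++⁺ʳ; ∈-++⁻; ∈-∃++)
open import Data.List.Properties
open import Data.List.Relation.Binary.Permutation.Propositional using (_↭_; prep; ↭-refl; ↭-sym; ↭-trans)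
open import Data.List.Relation.Binary.Permutation.Propositional.Properties using (∈-resp-↭; drop-∷; filter-↭; shift; ↭-length)
open import Data.List.Relation.Unary.All as All using (All; []; _∷_)
import Data.List.Relation.Unary.All.Properties as Allₚ
open import Data.List.Relation.Unary.AllPairs using (AllPairs; []; _∷_)
import Data.List.Relation.Unary.AllPairs.Properties as AllPairsₚ
open import Data.List.Relation.Unary.Any using (here; there)
open import Data.List.Relation.Unary.Sorted.TotalOrder.Properties using (Sorted⇒AllPairs)
import Data.List.Sort.InsertionSort.Properties as InsertionSortₚ
open import Data.Maybe using (just; nothing; maybe′)
import Data.Maybe.Relation.Unary.All as MaybeAll
open import Data.Nat
open import Data.Nat.Properties
open import Data.List.Membership.DecPropositional _≟_ using (_∈?_)
open import Data.Product using (∃; _×_; _,_; proj₁; proj₂)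
open import Data.Product.Properties using () renaming (≡-dec to ×-≡-dec)
open import Data.Sum using (_⊎_; inj₁; inj₂; [_,_]′)
open import Data.Tree.Binary using (leaf; node)
open import Data.Unit using (tt)
open import Data.Vec using (Vec; lookup; tabulate)
open import Data.Vec.Properties using (lookup∘tabulate)
open import Function using (_∘_; case_of_; id)
open import Function.Bundles using (Equivalence)
open import Relation.Binary.Bundles using (DecTotalOrder)
open import Relation.Binary.Construct.Flip.EqAndOrd using (decTotalOrder)
open import Relation.Binary.PropositionalEquality
open import Relation.Nullary using (yes; no; ¬_; ¬?; _×-dec_; contradiction; does)
open import Relation.Nullary.Decidable using (dec-true; dec-false)
open import Relation.Unary using (Decidable; ∁)

-- The nodes of asctops(T) and their paths

-- Why an insertion lands correctly: before step `j` only left subtrees of off-diagonal nodes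
-- labeled at most `j` are missing, and labels strictly drop on entering a left subtree, so no
-- letter `j` has been deleted. Deletion does not reorder letters, so the node that carries the
-- first `j` of the full word still carries the leftmost one. The restored piece is a bare right
-- path because its nodes have labels below `j`, so their own left subtrees are still missing. The
-- obstacle is that being a first occurrence depends on the whole preceding word, while trees are
-- handled by recursion; hence `Inner` carries the letters before the subtree as a parameter.

module _ {A B : Set} {f : A → B} where

  filter-map : ∀ {P : B → Set} {Q : A → Set} (P? : Decidable P) (Q? : Decidable Q) →
    (∀ x → does (P? (f x)) ≡ does (Q? x)) →
    ∀ xs → filter P? (map f xs) ≡ map f (filter Q? xs)
  filter-map P? Q? eq []       = refl
  filter-map P? Q? eq (x ∷ xs) rewrite eq x with does (Q? x)
  ... | true  = cong (f x ∷_) (filter-map P? Q? eq xs)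
  ... | false = filter-map P? Q? eq xs

word : BinTree → Word
word (leaf _)     = []
word (node l a r) = word l ++ a ∷ word r

spine : BinTree → Word
spine (leaf _)     = []
spine (node _ a r) = a ∷ spine r

-- The nodes with a left child, as pairs of their label and the labels of the
-- maximal right path starting at that child.
innerTops : BinTree → List (ℕ × Word)
innerTops (leaf _)                 = []
innerTops (node (leaf _) _ r)       = innerTops r
innerTops (node l@(node _ _ _) a r) = innerTops l ++ (a , spine l) ∷ innerTops r

-- The nodes of asctops(T), as pairs of their label i and the labels of W_i.
tops : BinTree → List (ℕ × Word)
tops (leaf _)     = []
tops (node l a r) = tops l ++ (a , a ∷ spine r) ∷ innerTops r

childPath : ∀ {t} → Node t → List (Node t)
childPath v = maybe′ rpath [] (leftChild v)

map-rootRightPath : ∀ t → map label (rootRightPath t) ≡ spine t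
map-rootRightPath (leaf _)     = refl
map-rootRightPath (node _ a r) =
  cong (a ∷_) (trans (sym (map-∘ (rootRightPath r))) (map-rootRightPath r))

-- A left child starts a right path of its own. So `rpath (inʳ w)` takes the branch that does not
-- extend the path up to the root, and `childPath` commutes with `inʳ`.
leftChild-offRootPath : ∀ {t} (v : Node t) {w} → leftChild v ≡ just w →
  onRootRightPath w ≡ false
leftChild-offRootPath (root {l = node _ _ _}) refl = refl
leftChild-offRootPath (inˡ v) eq with leftChild v
leftChild-offRootPath (inˡ v) refl | just _ = refl
leftChild-offRootPath (inʳ v) eq with leftChild v in e
leftChild-offRootPath (inʳ v) refl | just _ = leftChild-offRootPath v e

childPath-inˡ : ∀ {l a r} (v : Node l) → childPath (inˡ {a = a} {r} v) ≡ map inˡ (childPath v)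
childPath-inˡ v with leftChild v
... | just _  = refl
... | nothing = refl

childPath-inʳ : ∀ {l a r} (v : Node r) → childPath (inʳ {l} {a} v) ≡ map inʳ (childPath v)
childPath-inʳ v with leftChild v in eq
... | nothing = refl
... | just w rewrite leftChild-offRootPath v eq = refl

pathOf-inˡ : ∀ {l a r} (v : Node l) → pathOf (inˡ {a = a} {r} v) ≡ map inˡ (pathOf v)
pathOf-inˡ v with inDiag v
... | true  = refl
... | false = childPath-inˡ v

hasLeftChild?-inˡ : ∀ {l a r} (v : Node l) →
  does (hasLeftChild? (inˡ {a = a} {r} v)) ≡ does (hasLeftChild? v)
hasLeftChild?-inˡ v with leftChild v
... | just _  = refl
... | nothing = refl

hasLeftChild?-inʳ : ∀ {l a r} (v : Node r) →
  does (hasLeftChild? (inʳ {l} {a} v)) ≡ does (hasLeftChild? v)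
hasLeftChild?-inʳ v with leftChild v
... | just _  = refl
... | nothing = refl

-- The node listed without a test lies in the left subtree, or is the root if that subtree is empty;
-- a root below which there is a left subtree passes the filter.
asctopsT-node : ∀ l a r → asctopsT (node l a r) ≡
  map inˡ (asctopsT l) ++ root ∷ map inʳ (filter hasLeftChild? (inorder r))
asctopsT-node (leaf _) a r =
  cong (root ∷_) (filter-map hasLeftChild? hasLeftChild? hasLeftChild?-inʳ (inorder r))
asctopsT-node l@(node l₁ _ _) a r with inorder l in eq
... | []     = contradiction (++-conicalʳ (map inˡ (inorder l₁)) _ eq) λ ()
... | v ∷ vs = cong (inˡ v ∷_) (begin
  filter hasLeftChild? (map inˡ vs ++ root ∷ map inʳ (inorder r))
    ≡⟨ filter-++ hasLeftChild? (map inˡ vs) _ ⟩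
  filter hasLeftChild? (map inˡ vs) ++ root ∷ filter hasLeftChild? (map inʳ (inorder r))
    ≡⟨ cong₂ (λ xs ys → xs ++ root ∷ ys)
         (filter-map hasLeftChild? hasLeftChild? hasLeftChild?-inˡ vs)
         (filter-map hasLeftChild? hasLeftChild? hasLeftChild?-inʳ (inorder r)) ⟩
  map inˡ (filter hasLeftChild? vs) ++ root ∷ map inʳ (filter hasLeftChild? (inorder r)) ∎)
  where open ≡-Reasoning

map-label-child : ∀ {t t′} {f : Node t → Node t′} → (∀ v → label (f v) ≡ label v) →
  {p : Node t → List (Node t)} {p′ : Node t′ → List (Node t′)} →
  (∀ v → p′ (f v) ≡ map f (p v)) →
  ∀ vs → map (λ v → label v , map label (p′ v)) (map f vs) ≡
         map (λ v → label v , map label (p v)) vs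
map-label-child {f = f} lab {p} {p′} path vs = trans (sym (map-∘ vs)) (map-cong (λ v →
  cong₂ _,_ (lab v) (trans (cong (map label) (path v))
    (trans (sym (map-∘ (p v))) (map-cong lab (p v))))) vs)

innerTops-correct : ∀ t →
  map (λ v → label v , map label (childPath v)) (filter hasLeftChild? (inorder t)) ≡ innerTops t
innerTops-correct (leaf _) = refl
innerTops-correct (node (leaf _) a r) = trans
  (cong (map _) (filter-map hasLeftChild? hasLeftChild? hasLeftChild?-inʳ (inorder r)))
  (trans (map-label-child (λ _ → refl) childPath-inʳ (filter hasLeftChild? (inorder r)))
         (innerTops-correct r))
innerTops-correct (node l@(node _ _ _) a r) = begin
  map entry (filter hasLeftChild? (map inˡ (inorder l) ++ root ∷ map inʳ (inorder r)))
    ≡⟨ cong (map entry) (filter-++ hasLeftChild? (map inˡ (inorder l)) _) ⟩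
  map entry (filter hasLeftChild? (map inˡ (inorder l)) ++ root ∷ filter hasLeftChild? (map inʳ (inorder r)))
    ≡⟨ cong (map entry) (cong₂ (λ xs ys → xs ++ root ∷ ys)
         (filter-map hasLeftChild? hasLeftChild? hasLeftChild?-inˡ (inorder l))
         (filter-map hasLeftChild? hasLeftChild? hasLeftChild?-inʳ (inorder r))) ⟩
  map entry (map inˡ (filter hasLeftChild? (inorder l)) ++ root ∷ map inʳ (filter hasLeftChild? (inorder r)))
    ≡⟨ map-++ entry (map inˡ (filter hasLeftChild? (inorder l))) _ ⟩
  map entry (map inˡ (filter hasLeftChild? (inorder l))) ++
    entry root ∷ map entry (map inʳ (filter hasLeftChild? (inorder r)))
    ≡⟨ cong₂ _++_
         (trans (map-label-child (λ _ → refl) childPath-inˡ (filter hasLeftChild? (inorder l)))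
                (innerTops-correct l))
         (cong₂ _∷_ (cong (a ,_) (trans (sym (map-∘ (rootRightPath l))) (map-rootRightPath l)))
           (trans (map-label-child (λ _ → refl) childPath-inʳ (filter hasLeftChild? (inorder r)))
                  (innerTops-correct r))) ⟩
  innerTops l ++ (a , spine l) ∷ innerTops r ∎
  where
  open ≡-Reasoning
  entry : Node (node l a r) → ℕ × Word
  entry v = label v , map label (childPath v)

tops-correct : ∀ t → map (λ v → label v , map label (pathOf v)) (asctopsT t) ≡ tops t
tops-correct (leaf _) = refl
tops-correct (node l a r) = begin
  map entry (asctopsT (node l a r))
    ≡⟨ cong (map entry) (asctopsT-node l a r) ⟩
  map entry (map inˡ (asctopsT l) ++ root ∷ map inʳ (filter hasLeftChild? (inorder r)))
    ≡⟨ map-++ entry (map inˡ (asctopsT l)) _ ⟩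
  map entry (map inˡ (asctopsT l)) ++
    entry root ∷ map entry (map inʳ (filter hasLeftChild? (inorder r)))
    ≡⟨ cong₂ _++_
         (trans (map-label-child (λ _ → refl) pathOf-inˡ (asctopsT l)) (tops-correct l))
         (cong₂ _∷_ (cong (a ,_) (map-rootRightPath (node l a r)))
           -- `inDiag (inʳ v)` is `false`, so `pathOf (inʳ v)` reduces to `childPath (inʳ v)`.
           (trans (map-label-child (λ _ → refl) childPath-inʳ (filter hasLeftChild? (inorder r)))
                  (innerTops-correct r))) ⟩
  tops l ++ (a , a ∷ spine r) ∷ innerTops r ∎
  where
  open ≡-Reasoning
  entry : Node (node l a r) → ℕ × Word
  entry v = label v , map label (pathOf v)

pathAt : ℕ → List (ℕ × Word) → Word
pathAt i cs = maybe′ proj₂ [] (head (filter (λ c → proj₁ c ≟ i) cs))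

pathAt-∈ : ∀ {i p} cs → (i , p) ∈ cs → (i , pathAt i cs) ∈ cs
pathAt-∈ {i} ((j , q) ∷ cs) h with j ≟ i
... | yes refl rewrite filter-accept (λ c → proj₁ c ≟ i) {i , q} {cs} refl = here refl
... | no j≢i rewrite filter-reject (λ c → proj₁ c ≟ i) {j , q} {cs} j≢i with h
...   | here refl = contradiction refl j≢i
...   | there h′  = there (pathAt-∈ cs h′)

W-labels : ∀ t i → map label (W t i) ≡ pathAt i (tops t)
W-labels t i = begin
  map label (maybe′ pathOf [] (head (filter (λ v → label v ≟ i) (asctopsT t))))
    ≡⟨ first-path (filter (λ v → label v ≟ i) (asctopsT t)) ⟨
  maybe′ proj₂ [] (head (map entry (filter (λ v → label v ≟ i) (asctopsT t))))
    ≡⟨ cong (maybe′ proj₂ [] ∘ head)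
         (filter-map (λ c → proj₁ c ≟ i) (λ v → label v ≟ i) (λ _ → refl) (asctopsT t)) ⟨
  pathAt i (map entry (asctopsT t))
    ≡⟨ cong (pathAt i) (tops-correct t) ⟩
  pathAt i (tops t) ∎
  where
  open ≡-Reasoning
  entry : Node t → ℕ × Word
  entry v = label v , map label (pathOf v)
  first-path : ∀ vs → maybe′ proj₂ [] (head (map entry vs)) ≡ map label (maybe′ pathOf [] (head vs))
  first-path []      = refl
  first-path (_ ∷ _) = refl

-- Trees of modified ascent sequences

-- Strict on the left and weak on the right because `ᾱ` splits at the leftmost maximum.
data Decreasing : BinTree → Set where
  leaf : Decreasing (leaf tt)
  node : ∀ {l a r} → Decreasing l → All (_< a) (word l) →
         Decreasing r → All (_≤ a) (word r) → Decreasing (node l a r)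

max-upper : ∀ x → All (_≤ max x) x
max-upper []      = []
max-upper (a ∷ x) =
  m≤m⊔n a (max x) ∷ All.map (λ b≤ → ≤-trans b≤ (m≤n⊔m a (max x))) (max-upper x)

max-∈ : ∀ a x → max (a ∷ x) ∈ a ∷ x
max-∈ a [] rewrite ⊔-identityʳ a = here refl
max-∈ a (b ∷ x) with ⊔-sel a (max (b ∷ x))
... | inj₁ eq = here eq
... | inj₂ eq rewrite eq = there (max-∈ b x)

span-split : ∀ {P : ℕ → Set} (P? : Decidable P) x {u v} → span P? x ≡ (u , v) →
  x ≡ u ++ v × All P u × MaybeAll.All (∁ P) (head v)
span-split P? x eq with trans (sym (span-defn P? x)) eq
... | refl = sym (takeWhile++dropWhile P? x) , Allₚ.all-takeWhile P? x , Allₚ.all-head-dropWhile P? x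

ᾱ-fuel-correct : ∀ n x → length x ≤ n → word (ᾱ-fuel n x) ≡ x × Decreasing (ᾱ-fuel n x)
ᾱ-fuel-correct zero [] _ = refl , leaf
ᾱ-fuel-correct (suc n) x len with span (_<? max x) x in eq
ᾱ-fuel-correct (suc n) []      len | _ , [] = refl , leaf
ᾱ-fuel-correct (suc n) x@(a ∷ x′) len | u , [] with span-split (_<? max x) x eq
-- With an empty remainder the maximum, itself a letter of `x`, would be below itself.
... | x≡u , u<max , _ = contradiction
  (All.lookup (subst (All (_< max x)) (sym (trans x≡u (++-identityʳ u))) u<max) (max-∈ a x′))
  (<-irrefl refl)
ᾱ-fuel-correct (suc n) x len | u , m ∷ w with span-split (_<? max x) x eq
... | x≡ , u<max , MaybeAll.just m≮max
  -- The letter that stops the span is not below the maximum, so it is the maximum.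
  with refl ← ≤-antisym (All.lookup (max-upper x) (subst (m ∈_) (sym x≡) (∈-++⁺ʳ u (here refl))))
                        (≮⇒≥ m≮max)
  with uw<n ← ≤-trans (≤-reflexive (sym (trans (cong length x≡) (trans (length-++ u) (+-suc (length u) (length w)))))) len
  with ᾱ-fuel-correct n u (≤-pred (≤-trans (s≤s (m≤m+n (length u) (length w))) uw<n))
     | ᾱ-fuel-correct n w (≤-pred (≤-trans (s≤s (m≤n+m (length w) (length u))) uw<n))
... | eqᵘ , decᵘ | eqʷ , decʷ =
  trans (cong₂ (λ p q → p ++ m ∷ q) eqᵘ eqʷ) (sym x≡) ,
  node decᵘ (subst (All (_< m)) (sym eqᵘ) u<max)
       decʷ (subst (All (_≤ m)) (sym eqʷ)
         (All.tail (Allₚ.++⁻ʳ u (subst (All (_≤ m)) x≡ (max-upper x)))))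

word-ᾱ : ∀ x → word (ᾱ x) ≡ x
word-ᾱ x = proj₁ (ᾱ-fuel-correct (length x) x ≤-refl)

ᾱ-decreasing : ∀ x → Decreasing (ᾱ x)
ᾱ-decreasing x = proj₂ (ᾱ-fuel-correct (length x) x ≤-refl)

-- Scan u x: in the word u ʳ++ x, every letter of x other than the first letter
-- of the word is an ascent top exactly if it is a first occurrence.
data Scan : Word → Word → Set where
  []    : ∀ {u} → Scan u []
  first : ∀ {a x} → Scan (a ∷ []) x → Scan [] (a ∷ x)
  next  : ∀ {u b a x} → (b < a → a ∉ b ∷ u) → (a ≤ b → a ∈ b ∷ u) →
          Scan (a ∷ b ∷ u) x → Scan (b ∷ u) (a ∷ x)

scan-++ʳ : ∀ {u} x {z} → Scan u (x ++ z) → Scan (x ʳ++ u) z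
scan-++ʳ []      s            = s
scan-++ʳ (a ∷ x) (first s)    = scan-++ʳ x s
scan-++ʳ (a ∷ x) (next _ _ s) = scan-++ʳ x s

scan-tail : ∀ {u a x} → Scan u (a ∷ x) → Scan (a ∷ u) x
scan-tail (first s)    = s
scan-tail (next _ _ s) = s

-- Only the last letter of `x` matters: it directly precedes `a` and is smaller, so `a` is an ascent
-- top. In `inner`, `x` is the word of a nonempty left subtree.
scan-ascent : ∀ {u a z} x → Scan (x ʳ++ u) (a ∷ z) → x ≢ [] → All (_< a) x → a ∉ x ʳ++ u
scan-ascent []          s            x≢[] _         = contradiction refl x≢[]
scan-ascent (c ∷ [])    (next f _ _) _    (c<a ∷ _) = f c<a
scan-ascent (c ∷ d ∷ x) s            _    (_ ∷ <a)  = scan-ascent (d ∷ x) s (λ ()) <a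

-- Positions and reversed prefixes

at-cast : ∀ {x i j a} → i ≡ j → x at i is a → x at j is a
at-cast refl p = p

at-functional : ∀ {x i a b} → x at i is a → x at i is b → a ≡ b
at-functional here      here      = refl
at-functional (there p) (there q) = at-functional p q

at-ʳ++⁺ : ∀ u {x i a} → x at i is a → (u ʳ++ x) at length u + i is a
at-ʳ++⁺ []      p = p
at-ʳ++⁺ (b ∷ u) {x} {i} p =
  at-cast (+-suc (length u) i) (at-ʳ++⁺ u {b ∷ x} (there p))

at-ʳ++⁻ : ∀ u {x i a} → (u ʳ++ x) at length u + suc i is a → x at suc i is a
at-ʳ++⁻ []      p = p
at-ʳ++⁻ (b ∷ u) {x} {i} {a} p
  with at-ʳ++⁻ u {b ∷ x} (at-cast {(b ∷ u) ʳ++ x} (sym (+-suc (length u) (suc i))) p)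
... | there q = q

∈⇒at : ∀ {u a} x → a ∈ u → ∃ λ h → h ≤ length u × (u ʳ++ x) at h is a
∈⇒at {b ∷ u} x (here refl) =
  length u + 1 , ≤-reflexive (+-comm (length u) 1) , at-ʳ++⁺ u here
∈⇒at {b ∷ u} x (there a∈u) with ∈⇒at (b ∷ x) a∈u
... | h , h≤ , p = h , m≤n⇒m≤1+n h≤ , p

at⇒∈ : ∀ u {x h a} → h ≤ length u → (u ʳ++ x) at h is a → a ∈ u
at⇒∈ []      z≤n ()
at⇒∈ (b ∷ u) {x} {a = a} h≤ p with m≤n⇒m<n∨m≡n h≤
... | inj₁ h<   = there (at⇒∈ u (≤-pred h<) p)
... | inj₂ refl with at-ʳ++⁻ u {b ∷ x} (at-cast {(b ∷ u) ʳ++ x} (+-comm 1 (length u)) p)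
...   | here = here refl

at-∈ : ∀ {x i a} → x at i is a → a ∈ x
at-∈ here      = here refl
at-∈ (there p) = there (at-∈ p)

-- The two conditions in `next` are the two inclusions between `asctops` and `nub` at the position
-- of `a`.
mas-scan : ∀ {y} → IsModifiedAscentSequence y → ∀ u x → y ≡ u ʳ++ x → Scan u x
mas-scan mas u        []      y≡ = []
mas-scan mas []       (a ∷ x) y≡ = first (mas-scan mas (a ∷ []) x y≡)
mas-scan {y} mas@((k , cayley) , top⇒nub , nub⇒top) (b ∷ u) (a ∷ x) y≡ =
  next new old (mas-scan mas (a ∷ b ∷ u) x y≡)
  where
  b-at : y at suc (length u) is b
  b-at rewrite y≡ = at-cast (+-comm (length u) 1) (at-ʳ++⁺ u {b ∷ a ∷ x} here)
  a-at : y at suc (suc (length u)) is a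
  a-at rewrite y≡ = at-cast (+-comm (suc (length u)) 1) (at-ʳ++⁺ (b ∷ u) {a ∷ x} here)
  new : b < a → a ∉ b ∷ u
  new b<a a∈ with ∈⇒at (a ∷ x) a∈
  ... | h , h≤ , p = <⇒≱ (s≤s h≤)
    (proj₂ (proj₂ (top⇒nub (a-at , inj₂ (_ , b , refl , b-at , b<a)))) h (subst (_at h is a) (sym y≡) p))
  old : a ≤ b → a ∈ b ∷ u
  old a≤b with a ∈? b ∷ u
  ... | yes a∈ = a∈
  ... | no a∉ with nub⇒top ((proj₁ (Equivalence.to (cayley a) (at-∈ a-at)) , All.lookup (max-upper y) (at-∈ a-at)) ,
                    a-at , λ h p → ≰⇒> (λ h≤ → a∉ (at⇒∈ (b ∷ u) h≤ (subst (_at h is a) y≡ p))))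
  -- `a` stands at position two or later, so `asctops` leaves only the case of a smaller
  -- predecessor, and the predecessor is `b`.
  ...   | _ , inj₂ (_ , b′ , refl , b′-at , b′<a) rewrite at-functional b′-at b-at =
    contradiction a≤b (<⇒≱ b′<a)

-- Inner u t and Outer t record which nodes of a Fishburn tree are first
-- occurrences of their labels, for a subtree t off the diagonal preceded in
-- the in-order traversal by the letters u, and for one with its root on the diagonal.
data Inner (u : Word) : BinTree → Set where
  leaf : Inner u (leaf tt)
  bare : ∀ {a r} → a ∈ u → Inner (a ∷ u) r → Inner u (node (leaf tt) a r)
  full : ∀ {l₁ b l₂ a r} → let l = node l₁ b l₂ in
         Inner u l → a ∉ word l ʳ++ u → Inner (a ∷ word l ʳ++ u) r → Inner u (node l a r)

data Outer : BinTree → Set where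
  leaf : Outer (leaf tt)
  node : ∀ {l a r} → Outer l → Inner (a ∷ reverse (word l)) r → Outer (node l a r)

-- A root without left child directly follows `b`, which bounds it, so it is no ascent top and
-- repeats a letter. A root with a left child directly follows a smaller letter of its left subtree,
-- so it is new.
inner : ∀ {t b u z} → Decreasing t → Scan (b ∷ u) (word t ++ z) → All (_≤ b) (word t) →
  Inner (b ∷ u) t
inner leaf _ _ = leaf
inner {node (leaf _) a r} (node _ _ dr ≤a) (next _ old s) (a≤b ∷ _) = bare (old a≤b) (inner dr s ≤a)
inner {node l@(node l₁ _ _) a r} {z = z} (node dl <a dr ≤a) s ≤b
  with s′ ← subst (Scan _) (++-assoc (word l) (a ∷ word r) z) s =
  full (inner dl s′ (Allₚ.++⁻ˡ (word l) ≤b))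
       (scan-ascent (word l) (scan-++ʳ (word l) s′) (λ eq → contradiction (++-conicalʳ (word l₁) _ eq) λ ()) <a)
       (inner dr (scan-tail (scan-++ʳ (word l) s′)) ≤a)

outer : ∀ {t z} → Decreasing t → Scan [] (word t ++ z) → Outer t
outer leaf _ = leaf
outer {node l a r} {z} (node dl <a dr ≤a) s
  with s′ ← subst (Scan _) (++-assoc (word l) (a ∷ word r) z) s =
  node (outer dl s′) (inner dr (scan-tail (scan-++ʳ (word l) s′)) ≤a)

mas-outer : ∀ {y} → IsModifiedAscentSequence y → Outer (ᾱ y)
mas-outer {y} mas = outer (ᾱ-decreasing y)
  (mas-scan mas [] _ (sym (trans (++-identityʳ _) (word-ᾱ y))))

-- Deleting left subtrees

sorted-↭-unique : ∀ {x y} → AllPairs _≥_ x → AllPairs _≥_ y → x ↭ y → x ≡ y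
sorted-↭-unique {[]}    {[]}    _ _ _ = refl
sorted-↭-unique {[]}    {b ∷ y} _ _ x↭y = contradiction (∈-resp-↭ (↭-sym x↭y) (here refl)) λ ()
sorted-↭-unique {a ∷ x} {[]}    _ _ x↭y = contradiction (∈-resp-↭ x↭y (here refl)) λ ()
sorted-↭-unique {a ∷ x} {b ∷ y} (≥x ∷ sx) (≥y ∷ sy) x↭y
  with ≤-antisym (bound ≥y (∈-resp-↭ x↭y (here refl))) (bound ≥x (∈-resp-↭ (↭-sym x↭y) (here refl)))
  where
  bound : ∀ {c d z} → All (d ≥_) z → c ∈ d ∷ z → c ≤ d
  bound ≥z (here refl) = ≤-refl
  bound ≥z (there c∈)  = All.lookup ≥z c∈
... | refl = cong (a ∷_) (sorted-↭-unique sx sy (drop-∷ x↭y))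

decreasing-unique : ∀ {B p} → AllPairs _≥_ p → B ↭ p → decreasing B ≡ p
decreasing-unique {B} sp B↭p =
  sorted-↭-unique (Sorted⇒AllPairs (DecTotalOrder.totalOrder ≥-order) (sort-↗ B)) sp
    (↭-trans (sort-↭ B) B↭p)
  where
  ≥-order = decTotalOrder ≤-decTotalOrder
  open InsertionSortₚ ≥-order using (sort-↗; sort-↭)

-- The diagonal nodes from bottom to top, each with its maximal right path.
diagTops : BinTree → List (ℕ × Word)
diagTops (leaf _)     = []
diagTops (node l a r) = diagTops l ++ (a , a ∷ spine r) ∷ []

offDiagTops : BinTree → List (ℕ × Word)
offDiagTops (leaf _)     = []
offDiagTops (node l a r) = offDiagTops l ++ innerTops r

tops-split : ∀ t {c} → c ∈ tops t → c ∈ diagTops t ⊎ c ∈ offDiagTops t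
tops-split (node l a r) c∈ with ∈-++⁻ (tops l) c∈
... | inj₂ (here eq)  = inj₁ (∈-++⁺ʳ (diagTops l) (here eq))
... | inj₂ (there c∈r) = inj₂ (∈-++⁺ʳ (offDiagTops l) c∈r)
... | inj₁ c∈l with tops-split l c∈l
...   | inj₁ d = inj₁ (∈-++⁺ˡ d)
...   | inj₂ o = inj₂ (∈-++⁺ˡ o)

All-spine : ∀ {P : ℕ → Set} t → All P (word t) → All P (spine t)
All-spine (leaf _)     _  = []
All-spine (node l a r) ps with Allₚ.++⁻ʳ (word l) ps
... | pa ∷ pr = pa ∷ All-spine r pr

spine-sorted : ∀ {t} → Decreasing t → AllPairs _≥_ (spine t)
spine-sorted leaf = []
spine-sorted {node _ _ r} (node _ _ dr ≤a) = All-spine r ≤a ∷ spine-sorted dr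

innerTops-word : ∀ t {i p} → (i , p) ∈ innerTops t → i ∈ word t
innerTops-word (node (leaf _) a r) c∈ = there (innerTops-word r c∈)
innerTops-word (node l@(node _ _ _) a r) c∈ =
  [ ∈-++⁺ˡ ∘ innerTops-word l
  , (λ { (here refl) → ∈-++⁺ʳ (word l) (here refl)
       ; (there c∈r) → ∈-++⁺ʳ (word l) (there (innerTops-word r c∈r)) })
  ]′ (∈-++⁻ (innerTops l) c∈)

offDiagTops-word : ∀ t {i p} → (i , p) ∈ offDiagTops t → i ∈ word t
offDiagTops-word (node l a r) c∈ with ∈-++⁻ (offDiagTops l) c∈
... | inj₁ c∈l = ∈-++⁺ˡ (offDiagTops-word l c∈l)
... | inj₂ c∈r = ∈-++⁺ʳ (word l) (there (innerTops-word r c∈r))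

diagTops-word : ∀ t {i p} → (i , p) ∈ diagTops t → i ∈ word t
diagTops-word (node l a r) c∈ with ∈-++⁻ (diagTops l) c∈
... | inj₁ c∈l         = ∈-++⁺ˡ (diagTops-word l c∈l)
... | inj₂ (here refl) = ∈-++⁺ʳ (word l) (here refl)

-- First occurrences and the labels of tops

∈-ʳ++⁺ˡ : ∀ x {u} {a : ℕ} → a ∈ x → a ∈ x ʳ++ u
∈-ʳ++⁺ʳ : ∀ x {u} {a : ℕ} → a ∈ u → a ∈ x ʳ++ u
∈-ʳ++⁺ˡ (b ∷ x) (here eq)  = ∈-ʳ++⁺ʳ x (here eq)
∈-ʳ++⁺ˡ (b ∷ x) (there a∈) = ∈-ʳ++⁺ˡ x a∈
∈-ʳ++⁺ʳ []      a∈ = a∈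
∈-ʳ++⁺ʳ (b ∷ x) a∈ = ∈-ʳ++⁺ʳ x (there a∈)

∈-ʳ++⁻ : ∀ x {u} {a : ℕ} → a ∈ x ʳ++ u → a ∈ x ⊎ a ∈ u
∈-ʳ++⁻ []      a∈ = inj₂ a∈
∈-ʳ++⁻ (b ∷ x) a∈ with ∈-ʳ++⁻ x a∈
... | inj₁ a∈x         = inj₁ (there a∈x)
... | inj₂ (here eq)   = inj₁ (here eq)
... | inj₂ (there a∈u) = inj₂ a∈u

-- The prefix only grows along the traversal, so freshness at the top descends to `u`. This is what
-- separates the labels of tops in different subtrees.
inner-fresh : ∀ {u t i p} → Inner u t → (i , p) ∈ innerTops t → i ∉ u
inner-fresh (bare _ ir) c∈ i∈u = inner-fresh ir c∈ (there i∈u)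
inner-fresh (full {l₁} {b} {l₂} il a∉ ir) c∈ i∈u with ∈-++⁻ (innerTops (node l₁ b l₂)) c∈
... | inj₁ c∈l         = inner-fresh il c∈l i∈u
... | inj₂ (here refl) = a∉ (∈-ʳ++⁺ʳ (word (node l₁ b l₂)) i∈u)
... | inj₂ (there c∈r) = inner-fresh ir c∈r (there (∈-ʳ++⁺ʳ (word (node l₁ b l₂)) i∈u))

-- Trace the letter back to an earlier copy: one that is old for the right subtree is the root's,
-- lies in `u`, or lies in the left subtree, where the induction applies.
inner-covers : ∀ {u t i} → Inner u t → i ∈ word t → i ∈ u ⊎ ∃ λ p → (i , p) ∈ innerTops t
inner-covers (bare a∈u ir) (here refl) = inj₁ a∈u
inner-covers (bare a∈u ir) (there i∈r) with inner-covers ir i∈r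
... | inj₁ (here refl)  = inj₁ a∈u
... | inj₁ (there i∈u)  = inj₁ i∈u
... | inj₂ c            = inj₂ c
inner-covers {i = i} (full {l₁} {b} {l₂} {a} {r} il a∉ ir) i∈ = go (∈-++⁻ (word l) i∈)
  where
  l = node l₁ b l₂
  left : i ∈ _ ⊎ (∃ λ p → (i , p) ∈ innerTops l) →
         i ∈ _ ⊎ (∃ λ p → (i , p) ∈ innerTops (node l a r))
  left (inj₁ i∈u)      = inj₁ i∈u
  left (inj₂ (p , c∈)) = inj₂ (p , ∈-++⁺ˡ c∈)
  go : i ∈ word l ⊎ i ∈ a ∷ word r → _
  go (inj₁ i∈l)         = left (inner-covers il i∈l)
  go (inj₂ (here refl)) = inj₂ (_ , ∈-++⁺ʳ (innerTops l) (here refl))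
  go (inj₂ (there i∈r)) with inner-covers ir i∈r
  ... | inj₂ (p , c∈)    = inj₂ (p , ∈-++⁺ʳ (innerTops l) (there c∈))
  ... | inj₁ (here refl) = inj₂ (_ , ∈-++⁺ʳ (innerTops l) (here refl))
  ... | inj₁ (there i∈)  with ∈-ʳ++⁻ (word l) i∈
  ...   | inj₁ i∈l = left (inner-covers il i∈l)
  ...   | inj₂ i∈u = inj₁ i∈u

-- Nothing precedes the whole tree, so no label is old. Hence `pathAt` finds a genuine path instead
-- of its default `[]`.
outer-covers : ∀ {t i} → Outer t → i ∈ word t → ∃ λ p → (i , p) ∈ tops t
outer-covers {node l a r} {i} (node ol ir) i∈ = go (∈-++⁻ (word l) i∈)
  where
  left : i ∈ word l → ∃ λ p → (i , p) ∈ tops (node l a r)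
  left i∈l with outer-covers ol i∈l
  ... | p , c∈ = p , ∈-++⁺ˡ c∈
  go : i ∈ word l ⊎ i ∈ a ∷ word r → _
  go (inj₁ i∈l)         = left i∈l
  go (inj₂ (here refl)) = _ , ∈-++⁺ʳ (tops l) (here refl)
  go (inj₂ (there i∈r)) with inner-covers ir i∈r
  ... | inj₂ (p , c∈)    = p , ∈-++⁺ʳ (tops l) (there c∈)
  ... | inj₁ (here refl) = _ , ∈-++⁺ʳ (tops l) (here refl)
  ... | inj₁ (there i∈)  with ∈-ʳ++⁻ (word l) i∈
  ...   | inj₁ i∈l = left i∈l

diag-off-disjoint : ∀ {t i p q} → Decreasing t → Outer t →
  (i , p) ∈ diagTops t → (i , q) ∉ offDiagTops t
diag-off-disjoint {node l a r} (node dl <a _ _) (node ol ir) d o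
  with ∈-++⁻ (diagTops l) d | ∈-++⁻ (offDiagTops l) o
... | inj₁ dₗ          | inj₁ oₗ = diag-off-disjoint dl ol dₗ oₗ
... | inj₂ (here refl) | inj₁ oₗ = <-irrefl refl (All.lookup <a (offDiagTops-word l oₗ))
... | inj₁ dₗ          | inj₂ oᵣ = inner-fresh ir oᵣ (there (∈-ʳ++⁺ˡ (word l) (diagTops-word l dₗ)))
... | inj₂ (here refl) | inj₂ oᵣ = inner-fresh ir oᵣ (here refl)

-- The path lies in the left subtree of its top, where labels are strictly smaller, whereas a path
-- on the diagonal contains its top. So the test `ownBlock?` of `α` recognizes the diagonal.
innerTops-block : ∀ {t i p} → Decreasing t → (i , p) ∈ innerTops t → i ∉ p × AllPairs _≥_ p
innerTops-block {node (leaf _) a r} (node _ _ dr _) c∈ = innerTops-block dr c∈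
innerTops-block {node l@(node _ _ _) a r} (node dl <a dr _) c∈ with ∈-++⁻ (innerTops l) c∈
... | inj₁ c∈l         = innerTops-block dl c∈l
... | inj₂ (here refl) =
  (λ a∈ → <-irrefl refl (All.lookup (All-spine l <a) a∈)) , spine-sorted dl
... | inj₂ (there c∈r) = innerTops-block dr c∈r

offDiagTops-block : ∀ {t i p} → Decreasing t → (i , p) ∈ offDiagTops t → i ∉ p × AllPairs _≥_ p
offDiagTops-block {node l a r} (node dl _ dr _) c∈ with ∈-++⁻ (offDiagTops l) c∈
... | inj₁ c∈l = offDiagTops-block dl c∈l
... | inj₂ c∈r = innerTops-block dr c∈r

diagTops-block : ∀ {t i p} → Decreasing t → (i , p) ∈ diagTops t → i ∈ p × AllPairs _≥_ p
diagTops-block {node l a r} (node dl _ dr ≤a) c∈ with ∈-++⁻ (diagTops l) c∈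
... | inj₁ c∈l         = diagTops-block dl c∈l
... | inj₂ (here refl) = here refl , All-spine r ≤a ∷ spine-sorted dr

-- Thus climbing the diagonal visits its blocks in the order in which `α` concatenates them.
diagTops-ascending : ∀ {t} → Decreasing t → AllPairs (λ c d → proj₁ c < proj₁ d) (diagTops t)
diagTops-ascending leaf = []
diagTops-ascending {node l _ _} (node dl <a _ _) = AllPairsₚ.++⁺ (diagTops-ascending dl) ([] ∷ [])
  (All.tabulate λ c∈ → All.lookup <a (diagTops-word l c∈) ∷ [])

-- prune J t and pruneDiag J t are the in-order words that remain after deleting
-- the left subtrees of the nodes (for pruneDiag, the nodes off the diagonal)
-- with labels at most J.  The block-insertion procedure runs through
-- pruneDiag J t with J decreasing.
prune : ℕ → BinTree → Word
prune J (leaf _)     = []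
prune J (node l a r) = (if does (J <? a) then prune J l else []) ++ a ∷ prune J r

pruneDiag : ℕ → BinTree → Word
pruneDiag J (leaf _)     = []
pruneDiag J (node l a r) = pruneDiag J l ++ a ∷ prune J r

prune-keep : ∀ {J l a r} → J < a → prune J (node l a r) ≡ prune J l ++ a ∷ prune J r
prune-keep {J} {l} {a} {r} J<a =
  cong (λ b → (if b then prune J l else []) ++ a ∷ prune J r) (dec-true (J <? a) J<a)

prune-cut : ∀ {J l a r} → a ≤ J → prune J (node l a r) ≡ a ∷ prune J r
prune-cut {J} {l} {a} {r} a≤J =
  cong (λ b → (if b then prune J l else []) ++ a ∷ prune J r) (dec-false (J <? a) (≤⇒≯ a≤J))

prune-leaf : ∀ J {a r} → prune J (node (leaf tt) a r) ≡ a ∷ prune J r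
prune-leaf J {a} with does (J <? a)
... | true  = refl
... | false = refl

prune-spine : ∀ {J} t → All (_≤ J) (word t) → prune J t ≡ spine t
prune-spine (leaf _)     _  = refl
prune-spine (node l a r) ≤J with Allₚ.++⁻ʳ (word l) ≤J
... | a≤J ∷ r≤J = trans (prune-cut {l = l} {r = r} a≤J) (cong (a ∷_) (prune-spine r r≤J))

prune-word : ∀ {J} t → All (J <_) (word t) → prune J t ≡ word t
prune-word (leaf _)     _  = refl
prune-word (node l a r) J< with Allₚ.++⁻ʳ (word l) J<
... | J<a ∷ J<r = trans (prune-keep {l = l} {r = r} J<a)
  (cong₂ (λ x y → x ++ a ∷ y) (prune-word l (Allₚ.++⁻ˡ (word l) J<)) (prune-word r J<r))

All-prune : ∀ {P : ℕ → Set} {J} t → All P (word t) → All P (prune J t)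
All-prune (leaf _)     _  = []
All-prune {J = J} (node l a r) ps with does (J <? a) | Allₚ.++⁻ʳ (word l) ps
... | true  | pa ∷ pr = Allₚ.++⁺ (All-prune l (Allₚ.++⁻ˡ (word l) ps)) (pa ∷ All-prune r pr)
... | false | pa ∷ pr = pa ∷ All-prune r pr

All-pruneDiag : ∀ {P : ℕ → Set} {J} t → All P (word t) → All P (pruneDiag J t)
All-pruneDiag (leaf _)     _  = []
All-pruneDiag (node l a r) ps with Allₚ.++⁻ʳ (word l) ps
... | pa ∷ pr = Allₚ.++⁺ (All-pruneDiag l (Allₚ.++⁻ˡ (word l) ps)) (pa ∷ All-prune r pr)

pruneDiag-word : ∀ {J} t → All (J <_) (word t) → pruneDiag J t ≡ word t
pruneDiag-word (leaf _)     _  = refl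
pruneDiag-word (node l a r) J< = cong₂ (λ x y → x ++ a ∷ y)
  (pruneDiag-word l (Allₚ.++⁻ˡ (word l) J<)) (prune-word r (All.tail (Allₚ.++⁻ʳ (word l) J<)))

pruneDiag-diagTops : ∀ {J} t → All (_≤ J) (word t) → concatMap proj₂ (diagTops t) ≡ pruneDiag J t
pruneDiag-diagTops (leaf _)     _  = refl
pruneDiag-diagTops (node l a r) ≤J = trans (concatMap-++ proj₂ (diagTops l) _) (cong₂ _++_
  (pruneDiag-diagTops l (Allₚ.++⁻ˡ (word l) ≤J))
  (cong (a ∷_) (trans (++-identityʳ (spine r))
    (sym (prune-spine r (All.tail (Allₚ.++⁻ʳ (word l) ≤J)))))))

-- `insertBefore` as a relation that survives in context: letters may be added on the right freely,
-- and on the left if none of them is `s`.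
record Splice (s : ℕ) (p x y : Word) : Set where
  constructor splice
  field
    {before after} : Word
    source : x ≡ before ++ s ∷ after
    fresh  : s ∉ before
    target : y ≡ before ++ p ++ s ∷ after

splice-++ˡ : ∀ {s p x y} w → s ∉ w → Splice s p x y → Splice s p (w ++ x) (w ++ y)
splice-++ˡ w s∉w (splice {x₁} refl s∉ refl) = splice (sym (++-assoc w x₁ _))
  (λ s∈ → [ s∉w , s∉ ]′ (∈-++⁻ w s∈)) (sym (++-assoc w x₁ _))

splice-++ʳ : ∀ {s p x y} w → Splice s p x y → Splice s p (x ++ w) (y ++ w)
splice-++ʳ {s} {p} w (splice {x₁} {x₂} refl s∉ refl) = splice (++-assoc x₁ _ w) s∉
  (trans (++-assoc x₁ _ w) (cong (x₁ ++_) (++-assoc p (s ∷ x₂) w)))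

insertBefore-splice : ∀ {s p x y} → Splice s p x y → insertBefore s p x ≡ y
insertBefore-splice {s} {p} (splice {x₁} {x₂} refl s∉ refl) = go x₁ s∉
  where
  go : ∀ x₁ → s ∉ x₁ → insertBefore s p (x₁ ++ s ∷ x₂) ≡ x₁ ++ p ++ s ∷ x₂
  go [] _ with s ≟ s
  ... | yes _  = refl
  ... | no s≢s = contradiction refl s≢s
  go (a ∷ x₁) s∉ with a ≟ s
  ... | yes refl = contradiction (here refl) s∉
  ... | no _     = cong (a ∷_) (go x₁ (s∉ ∘ there))

-- The thresholds `j` and `suc j` treat a node differently only if its label is `suc j`, and this is
-- visible only if it has a left child.
prune-same : ∀ {j} t → (∀ p → (suc j , p) ∉ innerTops t) → prune j t ≡ prune (suc j) t
prune-same (leaf _) _ = refl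
prune-same {j} (node (leaf _) a r) ∉tops = trans (prune-leaf j {r = r})
  (trans (cong (a ∷_) (prune-same r ∉tops)) (sym (prune-leaf (suc j) {r = r})))
prune-same {j} (node l@(node _ _ _) a r) ∉tops
  with prune-same l (λ p → ∉tops p ∘ ∈-++⁺ˡ)
     | prune-same r (λ p → ∉tops p ∘ ∈-++⁺ʳ (innerTops l) ∘ there) | j <? a
... | _ | same-r | no j≮a = trans (prune-cut {l = l} {r = r} (≮⇒≥ j≮a))
  (trans (cong (a ∷_) same-r) (sym (prune-cut {l = l} {r = r} (m≤n⇒m≤1+n (≮⇒≥ j≮a)))))
... | same-l | same-r | yes j<a with m≤n⇒m<n∨m≡n j<a
...   | inj₂ refl = contradiction (∈-++⁺ʳ (innerTops l) (here refl)) (∉tops _)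
...   | inj₁ sj<a = trans (prune-keep {l = l} {r = r} j<a)
  (trans (cong₂ (λ x y → x ++ a ∷ y) same-l same-r)
         (sym (prune-keep {l = l} {r = r} sj<a)))

pruneDiag-same : ∀ {j} t → (∀ p → (suc j , p) ∉ offDiagTops t) → pruneDiag j t ≡ pruneDiag (suc j) t
pruneDiag-same (leaf _)     _     = refl
pruneDiag-same (node l a r) ∉tops = cong₂ (λ x y → x ++ a ∷ y)
  (pruneDiag-same l (λ p → ∉tops p ∘ ∈-++⁺ˡ))
  (prune-same r (λ p → ∉tops p ∘ ∈-++⁺ʳ (offDiagTops l)))

-- Exactly one node with a left child has label `suc j`; its surroundings agree at both thresholds
-- by `prune-same`, and the letters before it avoid `suc j`.
splice-prune : ∀ {t u j p} → Decreasing t → Inner u t → (suc j , p) ∈ innerTops t →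
  Splice (suc j) p (prune (suc j) t) (prune j t)
splice-prune {node _ a r} {j = j} {p} (node _ _ dr _) (bare a∈u ir) c∈ =
  subst₂ (Splice (suc j) p) (sym (prune-leaf (suc j) {r = r})) (sym (prune-leaf j {r = r}))
    (splice-++ˡ (a ∷ []) (λ { (here refl) → inner-fresh ir c∈ (here refl) })
      (splice-prune dr ir c∈))
splice-prune {node l@(node _ _ _) a r} {j = j} {p} (node dl <a dr ≤a) (full il a∉ ir) c∈
  with ∈-++⁻ (innerTops l) c∈
... | inj₁ c∈l = subst₂ (Splice (suc j) p)
        (sym (prune-keep {l = l} {r = r} sj<a))
        (sym (trans (prune-keep {l = l} {r = r} (<⇒≤ sj<a)) (cong (λ x → prune j l ++ a ∷ x) same-r)))
        (splice-++ʳ (a ∷ prune (suc j) r) (splice-prune dl il c∈l))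
  where
  sj∈l = innerTops-word l c∈l
  sj<a = All.lookup <a sj∈l
  same-r = prune-same r λ q c∈r → inner-fresh ir c∈r (there (∈-ʳ++⁺ˡ (word l) sj∈l))
-- The root is the top: its left subtree has labels at most `j`, so at threshold `j` it reappears as
-- its `spine`.
... | inj₂ (here refl) = splice {before = []} (prune-cut {l = l} {r = r} ≤-refl) (λ ())
        (trans (prune-keep {l = l} {r = r} ≤-refl)
          (cong₂ (λ x y → x ++ a ∷ y) (prune-spine l (All.map ≤-pred <a))
            (prune-same r λ q c∈r → inner-fresh ir c∈r (here refl))))
... | inj₂ (there c∈r) with splice-prune dr ir c∈r | j <? a
...   | spl | no j≮a = subst₂ (Splice (suc j) p)
        (sym (prune-cut {l = l} {r = r} (m≤n⇒m≤1+n (≮⇒≥ j≮a)))) (sym (prune-cut {l = l} {r = r} (≮⇒≥ j≮a)))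
        (splice-++ˡ (a ∷ []) (λ { (here refl) → inner-fresh ir c∈r (here refl) }) spl)
...   | spl | yes j<a with m≤n⇒m<n∨m≡n j<a
-- A root labeled `suc j` would precede the top in `r`, which is a first occurrence.
...     | inj₂ refl = contradiction (here refl) (inner-fresh ir c∈r)
...     | inj₁ sj<a = subst₂ (Splice (suc j) p)
        (trans (++-assoc (prune (suc j) l) (a ∷ []) _) (sym (prune-keep {l = l} {r = r} sj<a)))
        (trans (++-assoc (prune (suc j) l) (a ∷ []) _)
          (trans (cong (λ x → x ++ a ∷ prune j r) (sym same-l)) (sym (prune-keep {l = l} {r = r} j<a))))
        (splice-++ˡ (prune (suc j) l ++ a ∷ []) (λ sj∈ → fresh (∈-++⁻ (prune (suc j) l) sj∈)) spl)
  where
  sj∉l : suc j ∉ word l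
  sj∉l sj∈l = inner-fresh ir c∈r (there (∈-ʳ++⁺ˡ (word l) sj∈l))
  same-l = prune-same l λ q c∈l → sj∉l (innerTops-word l c∈l)
  fresh : ¬ (suc j ∈ prune (suc j) l ⊎ suc j ∈ a ∷ [])
  fresh (inj₁ sj∈)         = All.lookup (All-prune l (Allₚ.¬Any⇒All¬ (word l) sj∉l)) sj∈ refl
  fresh (inj₂ (here refl)) = <-irrefl refl sj<a

splice-pruneDiag : ∀ {t j p} → Decreasing t → Outer t → (suc j , p) ∈ offDiagTops t →
  Splice (suc j) p (pruneDiag (suc j) t) (pruneDiag j t)
splice-pruneDiag {node l a r} {j} {p} (node dl <a dr ≤a) (node ol ir) c∈
  with ∈-++⁻ (offDiagTops l) c∈
... | inj₁ c∈l = subst (Splice (suc j) p (pruneDiag (suc j) l ++ a ∷ prune (suc j) r))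
        (cong (λ x → pruneDiag j l ++ a ∷ x) (sym same-r))
        (splice-++ʳ (a ∷ prune (suc j) r) (splice-pruneDiag dl ol c∈l))
  where
  same-r = prune-same r λ q c∈r →
    inner-fresh ir c∈r (there (∈-ʳ++⁺ˡ (word l) (offDiagTops-word l c∈l)))
... | inj₂ c∈r = subst₂ (Splice (suc j) p)
        (++-assoc (pruneDiag (suc j) l) (a ∷ []) _)
        (trans (++-assoc (pruneDiag (suc j) l) (a ∷ []) _)
          (cong (λ x → x ++ a ∷ prune j r) (sym same-l)))
        (splice-++ˡ (pruneDiag (suc j) l ++ a ∷ []) (λ sj∈ → fresh (∈-++⁻ (pruneDiag (suc j) l) sj∈))
          (splice-prune dr ir c∈r))
  where
  sj∉l : suc j ∉ word l
  sj∉l sj∈l = inner-fresh ir c∈r (there (∈-ʳ++⁺ˡ (word l) sj∈l))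
  same-l = pruneDiag-same l λ q c∈l → sj∉l (offDiagTops-word l c∈l)
  fresh : ¬ (suc j ∈ pruneDiag (suc j) l ⊎ suc j ∈ a ∷ [])
  fresh (inj₁ sj∈)         = All.lookup (All-pruneDiag l (Allₚ.¬Any⇒All¬ (word l) sj∉l)) sj∈ refl
  fresh (inj₂ (here refl)) = inner-fresh ir c∈r (here refl)

-- Block insertion

-- Lower end and length: recursion raises the first and lowers the second, so the upper end `m + n`
-- stays at `k` in the inductions below.
interval : ℕ → ℕ → List ℕ
interval m zero    = []
interval m (suc n) = suc m ∷ interval (suc m) n

[1⋯]-interval : ∀ k → [1⋯ k ] ≡ interval 0 k
[1⋯]-interval k = go k (λ _ → refl)
  where
  go : ∀ {m f} n → (∀ i → f i ≡ m + i) → map suc (applyUpTo f n) ≡ interval m n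
  go         zero    eq = refl
  go {m} {f} (suc n) eq = cong₂ _∷_ (cong suc (trans (eq 0) (+-identityʳ m)))
    (go n (λ i → trans (eq (suc i)) (+-suc m i)))

All-interval : ∀ {P : ℕ → Set} m n → (∀ {i} → m < i → i ≤ m + n → P i) → All P (interval m n)
All-interval m zero    p = []
All-interval m (suc n) p =
  p ≤-refl (≤-trans (s≤s (m≤m+n m n)) (≤-reflexive (sym (+-suc m n)))) ∷
  All-interval (suc m) n (λ m<i i≤ → p (<⇒≤ m<i) (≤-trans i≤ (≤-reflexive (sym (+-suc m n)))))

length-[1⋯] : ∀ k → length [1⋯ k ] ≡ k
length-[1⋯] k = trans (length-map suc (upTo k)) (length-upTo k)

length-blocks : ∀ (B : ℕ → Multiset) k → length (map B [1⋯ k ]) ≡ k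
length-blocks B k = trans (length-map B [1⋯ k ]) (length-[1⋯] k)

indexed-blocks : ∀ (B : ℕ → Multiset) k →
  indexed (map B [1⋯ k ]) ≡ map (λ i → i , B i) (interval 0 k)
indexed-blocks B k rewrite length-blocks B k = trans (zip-self [1⋯ k ]) (cong (map _) ([1⋯]-interval k))
  where
  zip-self : ∀ is → zip is (map B is) ≡ map (λ i → i , B i) is
  zip-self []       = refl
  zip-self (i ∷ is) = cong (_ ∷_) (zip-self is)

module _ {t k} (dt : Decreasing t) (ot : Outer t) (≤k : All (_≤ k) (word t)) (≥1 : All (1 ≤_) (word t))
  (surj : ∀ {i} → 1 ≤ i → i ≤ k → i ∈ word t)
  (B : ℕ → Multiset) (B↭ : ∀ {i} → 1 ≤ i → i ≤ k → B i ↭ pathAt i (tops t)) where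

  -- Ties the position of the top to the test on `B i`: `α` sees only the test, the pruned words
  -- only the position. Sorting turns `B i` back into the path.
  data Block (i : ℕ) : Set where
    diag : (i , decreasing (B i)) ∈ diagTops t → i ∈ B i → Block i
    off  : (i , decreasing (B i)) ∈ offDiagTops t → i ∉ B i → Block i

  block : ∀ {i} → 1 ≤ i → i ≤ k → Block i
  block {i} 1≤i i≤k
    with tops-split t (pathAt-∈ (tops t) (proj₂ (outer-covers ot (surj 1≤i i≤k))))
  ... | inj₁ d with diagTops-block dt d
  ...   | i∈p , sorted = diag
    (subst (λ p → (i , p) ∈ diagTops t) (sym (decreasing-unique sorted (B↭ 1≤i i≤k))) d)
    (∈-resp-↭ (↭-sym (B↭ 1≤i i≤k)) i∈p)
  block {i} 1≤i i≤k | inj₂ o with offDiagTops-block dt o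
  ...   | i∉p , sorted = off
    (subst (λ p → (i , p) ∈ offDiagTops t) (sym (decreasing-unique sorted (B↭ 1≤i i≤k))) o)
    (i∉p ∘ ∈-resp-↭ (B↭ 1≤i i≤k))

  entry : ℕ → ℕ × Multiset
  entry i = i , B i

  -- `cs` is the part of `diagTops t` with labels above `m`. Both lists ascend, so each diagonal
  -- index of the interval consumes the head of `cs`.
  own-blocks : ∀ m n cs → m + n ≡ k → AllPairs (λ c d → proj₁ c < proj₁ d) cs →
    All (λ c → m < proj₁ c) cs → (∀ c → c ∈ cs → c ∈ diagTops t) →
    (∀ c → m < proj₁ c → c ∈ diagTops t → c ∈ cs) →
    concatMap (decreasing ∘ proj₂) (filter ownBlock? (map entry (interval m n))) ≡ concatMap proj₂ cs
  own-blocks m zero [] m≡k _ _ _ _ = refl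
  own-blocks m zero (c ∷ cs) m≡k _ (m<c ∷ _) ⊆ _ = contradiction
    (All.lookup ≤k (diagTops-word t (⊆ c (here refl))))
    (<⇒≱ (subst (_< proj₁ c) (trans (sym (+-identityʳ m)) m≡k) m<c))
  own-blocks m (suc n) cs eq asc m< ⊆ ⊇
    with block {suc m} (s≤s z≤n) (≤-trans (s≤s (m≤m+n m n)) (≤-reflexive (trans (sym (+-suc m n)) eq)))
  ... | off o i∉ rewrite filter-reject ownBlock? {entry (suc m)} {map entry (interval (suc m) n)} i∉ =
    own-blocks (suc m) n cs (trans (sym (+-suc m n)) eq) asc
      (All.tabulate λ {c} c∈ → ≤∧≢⇒< (All.lookup m< c∈)
        λ { refl → diag-off-disjoint dt ot (⊆ _ c∈) o })
      ⊆ (λ c → ⊇ c ∘ <⇒≤)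
  own-blocks m (suc n) cs eq asc m< ⊆ ⊇
      | diag d i∈ rewrite filter-accept ownBlock? {entry (suc m)} {map entry (interval (suc m) n)} i∈
      with cs | asc | m< | ⊆ | ⊇ | ⊇ _ ≤-refl d
  ... | _ ∷ cs′ | c< ∷ asc′ | _ | ⊆ | ⊇ | here refl =
    cong (decreasing (B (suc m)) ++_)
      (own-blocks (suc m) n cs′ (trans (sym (+-suc m n)) eq) asc′ c< (λ c → ⊆ c ∘ there)
        λ c sm< c∈ → case ⊇ c (<⇒≤ sm<) c∈ of λ
          { (here c≡) → contradiction (sym (cong proj₁ c≡)) (<⇒≢ sm<) ; (there c∈cs) → c∈cs })
  -- Any other head would have a label strictly between `m` and `suc m`.
  ... | _ ∷ _ | c< ∷ _ | m<c ∷ _ | _ | _ | there d∈ = contradiction m<c (<⇒≱ (s≤s (≤-pred (All.lookup c< d∈))))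

  -- `foldr` on the ascending list treats the largest index first. A diagonal index inserts nothing,
  -- and lowering the threshold past it changes nothing, since no off-diagonal top has that label.
  insert-blocks : ∀ m n → m + n ≡ k →
    foldr (λ (j , C) x → insertBefore j (decreasing C) x) (pruneDiag k t)
      (filter (¬? ∘ ownBlock?) (map entry (interval m n))) ≡ pruneDiag m t
  insert-blocks m zero    eq = cong (λ j → pruneDiag j t) (trans (sym eq) (+-identityʳ m))
  insert-blocks m (suc n) eq
    with insert-blocks (suc m) n (trans (sym (+-suc m n)) eq)
       | block {suc m} (s≤s z≤n) (≤-trans (s≤s (m≤m+n m n)) (≤-reflexive (trans (sym (+-suc m n)) eq)))
  ... | ih | diag d i∈ rewrite filter-reject (¬? ∘ ownBlock?) {entry (suc m)} {map entry (interval (suc m) n)} (λ i∉ → i∉ i∈) =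
    trans ih (sym (pruneDiag-same t (λ p → diag-off-disjoint dt ot d)))
  ... | ih | off o i∉ rewrite filter-accept (¬? ∘ ownBlock?) {entry (suc m)} {map entry (interval (suc m) n)} i∉ =
    trans (cong (insertBefore (suc m) (decreasing (B (suc m)))) ih)
          (insertBefore-splice (splice-pruneDiag dt ot o))

  α-word : α (map B [1⋯ k ]) ≡ word t
  α-word = begin
    α (map B [1⋯ k ])
      ≡⟨ cong₂ (foldl insert) (cong (concatMap (decreasing ∘ proj₂) ∘ filter ownBlock?) (indexed-blocks B k))
           (cong (reverse ∘ filter (¬? ∘ ownBlock?)) (indexed-blocks B k)) ⟩
    foldl insert x⁰ (reverse (filter (¬? ∘ ownBlock?) (map entry (interval 0 k))))
      ≡⟨ reverse-foldl insert x⁰ (filter (¬? ∘ ownBlock?) (map entry (interval 0 k))) ⟩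
    foldr (λ c x → insert x c) x⁰ (filter (¬? ∘ ownBlock?) (map entry (interval 0 k)))
      ≡⟨ cong (λ x → foldr (λ c x → insert x c) x (filter (¬? ∘ ownBlock?) (map entry (interval 0 k))))
           (trans (own-blocks 0 k (diagTops t) refl (diagTops-ascending dt)
                    (All.tabulate λ c∈ → All.lookup ≥1 (diagTops-word t c∈)) (λ _ → id) (λ _ _ → id))
                  (pruneDiag-diagTops t ≤k)) ⟩
    foldr (λ c x → insert x c) (pruneDiag k t) (filter (¬? ∘ ownBlock?) (map entry (interval 0 k)))
      ≡⟨ insert-blocks 0 k refl ⟩
    pruneDiag 0 t
      ≡⟨ pruneDiag-word t ≥1 ⟩
    word t ∎
    where
    open ≡-Reasoning
    insert : Word → ℕ × Multiset → Word
    insert x (j , C) = insertBefore j (decreasing C) x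
    x⁰ = concatMap (decreasing ∘ proj₂) (filter ownBlock? (map entry (interval 0 k)))

-- Flipping covers and matrices

count : ℕ → List ℕ → ℕ
count j x = length (filter (_≟ j) x)

count-hit : ∀ j x → count j (j ∷ x) ≡ suc (count j x)
count-hit j x = cong length (filter-accept (_≟ j) {j} {x} refl)

count-miss : ∀ {a j} x → a ≢ j → count j (a ∷ x) ≡ count j x
count-miss {a} {j} x a≢j = cong length (filter-reject (_≟ j) {a} {x} a≢j)

count-∉ : ∀ {j} x → j ∉ x → count j x ≡ 0
count-∉ {j} x j∉ = cong length (filter-none (_≟ j)
  (All.tabulate λ a∈ a≡j → j∉ (subst (_∈ x) a≡j a∈)))

count-↭ : ∀ {x y} j → x ↭ y → count j x ≡ count j y
count-↭ j x↭y = ↭-length (filter-↭ (_≟ j) x↭y)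

count⇒↭ : ∀ x y → (∀ j → count j x ≡ count j y) → x ↭ y
count⇒↭ []      []      _  = ↭-refl
count⇒↭ []      (b ∷ y) eq = contradiction (trans (eq b) (count-hit b y)) λ ()
count⇒↭ (a ∷ x) y       eq with a ∈? y
... | no a∉y  = contradiction (trans (sym (count-hit a x)) (trans (eq a) (count-∉ y a∉y))) λ ()
... | yes a∈y with ∈-∃++ a∈y
...   | u , v , refl = ↭-trans (prep a (count⇒↭ x (u ++ v) eq′)) (↭-sym (shift a u v))
  where
  eq′ : ∀ j → count j x ≡ count j (u ++ v)
  eq′ j with a ≟ j | trans (eq j) (count-↭ j (shift a u v))
  ... | yes refl | e = suc-injective (trans (sym (count-hit a x)) (trans e (count-hit a (u ++ v))))
  ... | no a≢j   | e = trans (sym (count-miss x a≢j)) (trans e (count-miss (u ++ v) a≢j))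

count-map-label : ∀ {t} j (vs : List (Node t)) →
  count j (map label vs) ≡ length (filter (λ v → label v ≟ j) vs)
count-map-label j vs = trans
  (cong length (filter-map (_≟ j) (λ v → label v ≟ j) (λ _ → refl) vs))
  (length-map label (filter (λ v → label v ≟ j) vs))

-- The block with index `i` in `fromColumns`.
row : ℕ → List (ℕ × ℕ) → Multiset
row i cs = map proj₂ (filter (λ c → proj₁ c ≟ i) cs)

row-accept : ∀ i j cs → row i ((i , j) ∷ cs) ≡ j ∷ row i cs
row-accept i j cs = cong (map proj₂) (filter-accept (λ c → proj₁ c ≟ i) {i , j} {cs} refl)

row-reject : ∀ {i′ i j} cs → i′ ≢ i → row i ((i′ , j) ∷ cs) ≡ row i cs
row-reject {i′} {i} {j} cs i′≢i =
  cong (map proj₂) (filter-reject (λ c → proj₁ c ≟ i) {i′ , j} {cs} i′≢i)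

count-row-hit : ∀ i j cs → count j (row i ((i , j) ∷ cs)) ≡ suc (count j (row i cs))
count-row-hit i j cs = trans (cong (count j) (row-accept i j cs)) (count-hit j (row i cs))

count-row-miss : ∀ {c} i j cs → c ≢ (i , j) → count j (row i (c ∷ cs)) ≡ count j (row i cs)
count-row-miss {i′ , j′} i j cs c≢ with i′ ≟ i
... | no i′≢i  = cong (count j) (row-reject cs i′≢i)
... | yes refl = trans (cong (count j) (row-accept i j′ cs))
                       (count-miss {j′} (row i cs) λ { refl → c≢ refl })

InRange : ℕ → ℕ → Set
InRange k i = 1 ≤ i × i ≤ k

complement-range : ∀ {k i} → InRange k i → InRange k (k + 1 ∸ i)
complement-range {k} {i} (1≤i , i≤k) =
  m<n⇒0<n∸m (≤-trans (s≤s i≤k) (≤-reflexive (+-comm 1 k))) ,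
  ≤-trans (∸-monoʳ-≤ (k + 1) 1≤i) (≤-reflexive (m+n∸n≡m k 1))

-- Truncated subtraction is an involution only up to `k + 1`, so ranges accompany every flip.
complement-involutive : ∀ {k i} → InRange k i → k + 1 ∸ (k + 1 ∸ i) ≡ i
complement-involutive {k} (_ , i≤k) = m∸[m∸n]≡n (≤-trans i≤k (m≤m+n k 1))

flipColumn : ℕ → ℕ × ℕ → ℕ × ℕ
flipColumn k (i , j) = k + 1 ∸ j , k + 1 ∸ i

-- Since `flipColumn k` is an involution on columns in range, a flipped column is `(i , j)` exactly
-- if the original was the flip of `(i , j)`.
count-flip : ∀ {k i j} cs → All (λ c → InRange k (proj₁ c) × InRange k (proj₂ c)) cs →
  InRange k i → InRange k j →
  count j (row i (map (flipColumn k) cs)) ≡ count (k + 1 ∸ i) (row (k + 1 ∸ j) cs)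
count-flip [] _ _ _ = refl
count-flip {k} {i} {j} ((i′ , j′) ∷ cs) ((ri′ , rj′) ∷ rs) ri rj
  with count-flip cs rs ri rj | ×-≡-dec _≟_ _≟_ (i′ , j′) (k + 1 ∸ j , k + 1 ∸ i)
... | ih | yes refl rewrite complement-involutive ri | complement-involutive rj =
  trans (count-row-hit i j (map (flipColumn k) cs))
        (trans (cong suc ih) (sym (count-row-hit (k + 1 ∸ j) (k + 1 ∸ i) cs)))
... | ih | no ≢ = trans
  (count-row-miss {flipColumn k (i′ , j′)} i j (map (flipColumn k) cs)
    λ { refl → ≢ (cong₂ _,_ (sym (complement-involutive ri′)) (sym (complement-involutive rj′))) })
  (trans ih (sym (count-row-miss {i′ , j′} (k + 1 ∸ j) (k + 1 ∸ i) cs ≢)))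

module _ (B : ℕ → Multiset) where

  blockColumns : List ℕ → List (ℕ × ℕ)
  blockColumns is = concatMap (λ (i , C) → map (i ,_) C) (map (λ i → i , B i) is)

  row-++ : ∀ i cs ds → row i (cs ++ ds) ≡ row i cs ++ row i ds
  row-++ i cs ds = trans (cong (map proj₂) (filter-++ (λ c → proj₁ c ≟ i) cs ds))
                         (map-++ proj₂ (filter (λ c → proj₁ c ≟ i) cs) _)

  row-own : ∀ i x → row i (map (i ,_) x) ≡ x
  row-own i []      = refl
  row-own i (a ∷ x) = trans (row-accept i a (map (i ,_) x)) (cong (a ∷_) (row-own i x))

  row-other : ∀ {i i′} x → i′ ≢ i → row i (map (i′ ,_) x) ≡ []
  row-other []      _    = refl
  row-other (a ∷ x) i′≢i = trans (row-reject (map (_ ,_) x) i′≢i) (row-other x i′≢i)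

  row-later : ∀ {i} m n → i ≤ m → row i (blockColumns (interval m n)) ≡ []
  row-later m zero    _   = refl
  row-later {i} m (suc n) i≤m = trans (row-++ i (map (suc m ,_) (B (suc m))) _)
    (cong₂ _++_ (row-other (B (suc m)) (λ { refl → <-irrefl refl i≤m }))
                (row-later (suc m) n (m≤n⇒m≤1+n i≤m)))

  row-blockColumns : ∀ {i} m n → m < i → i ≤ m + n → row i (blockColumns (interval m n)) ≡ B i
  row-blockColumns m zero m<i i≤ =
    contradiction (≤-trans i≤ (≤-reflexive (+-identityʳ m))) (<⇒≱ m<i)
  row-blockColumns {i} m (suc n) m<i i≤ with m≤n⇒m<n∨m≡n m<i
  ... | inj₂ refl = trans (row-++ i (map (i ,_) (B i)) _)
    (trans (cong₂ _++_ (row-own i (B i)) (row-later i n ≤-refl)) (++-identityʳ (B i)))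
  ... | inj₁ sm<i = trans (row-++ i (map (suc m ,_) (B (suc m))) _)
    (cong₂ _++_ (row-other (B (suc m)) (<⇒≢ sm<i))
      (row-blockColumns (suc m) n sm<i (≤-trans i≤ (≤-reflexive (+-suc m n)))))

  All-blockColumns : ∀ {P : ℕ → Set} {is} → All P is → (∀ i → All P (B i)) →
    All (λ c → P (proj₁ c) × P (proj₂ c)) (blockColumns is)
  All-blockColumns []        _  = []
  All-blockColumns (pi ∷ ps) pB =
    Allₚ.++⁺ (Allₚ.map⁺ (All.map (pi ,_) (pB _))) (All-blockColumns ps pB)

  columns-blocks : ∀ k → columns (map B [1⋯ k ]) ≡ blockColumns (interval 0 k)
  columns-blocks k = cong (concatMap _) (indexed-blocks B k)

  flipCover-blocks : ∀ k → flipCover (map B [1⋯ k ]) ≡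
    map (λ i → row i (map (flipColumn k) (blockColumns (interval 0 k)))) [1⋯ k ]
  flipCover-blocks k = cong₂ (λ n cs → fromColumns n (map (flipColumn n) cs))
    (length-blocks B k) (columns-blocks k)

-- Label ranges and matrix entries

label-∈ : ∀ {t} (v : Node t) → label v ∈ word t
label-∈ (root {l})     = ∈-++⁺ʳ (word l) (here refl)
label-∈ (inˡ v)        = ∈-++⁺ˡ (label-∈ v)
label-∈ (inʳ {l} v)    = ∈-++⁺ʳ (word l) (there (label-∈ v))

max-++ : ∀ x y → max (x ++ y) ≡ max x ⊔ max y
max-++ []      y = refl
max-++ (a ∷ x) y = trans (cong (a ⊔_) (max-++ x y)) (sym (⊔-assoc a (max x) (max y)))

maxT-word : ∀ t → maxT t ≡ max (word t)
maxT-word (leaf _)     = refl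
maxT-word (node l a r) = begin
  a ⊔ (maxT l ⊔ maxT r)             ≡⟨ cong₂ (λ m n → a ⊔ (m ⊔ n)) (maxT-word l) (maxT-word r) ⟩
  a ⊔ (max (word l) ⊔ max (word r)) ≡⟨ ⊔-assoc a _ _ ⟨
  a ⊔ max (word l) ⊔ max (word r)   ≡⟨ cong (_⊔ max (word r)) (⊔-comm a _) ⟩
  max (word l) ⊔ a ⊔ max (word r)   ≡⟨ ⊔-assoc (max (word l)) a _ ⟩
  max (word l) ⊔ (a ⊔ max (word r)) ≡⟨ max-++ (word l) (a ∷ word r) ⟨
  max (word l ++ a ∷ word r)        ∎
  where open ≡-Reasoning

maxT-ᾱ : ∀ x → maxT (ᾱ x) ≡ max x
maxT-ᾱ x = trans (maxT-word (ᾱ x)) (cong max (word-ᾱ x))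

cayley-range : ∀ {x} → IsCayley x → All (InRange (max x)) x
cayley-range {x} (k , cay) = All.tabulate λ {j} j∈ →
  proj₁ (Equivalence.to (cay j) j∈) , All.lookup (max-upper x) j∈

cayley-surjective : ∀ {x i} → IsCayley x → InRange (max x) i → i ∈ x
cayley-surjective {[]}    _         (1≤i , i≤0) = contradiction i≤0 (<⇒≱ 1≤i)
-- `IsCayley` brings its own bound `k`; the maximum is a letter, hence at most `k`.
cayley-surjective {a ∷ x} (k , cay) (1≤i , i≤m) = Equivalence.from (cay _)
  (1≤i , ≤-trans i≤m (proj₂ (Equivalence.to (cay _) (max-∈ a x))))

ᾱ-range : ∀ {x} → IsCayley x → All (InRange (maxT (ᾱ x))) (word (ᾱ x))
ᾱ-range {x} cay rewrite maxT-ᾱ x | word-ᾱ x = cayley-range cay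

ᾱ-surjective : ∀ {x i} → IsCayley x → InRange (maxT (ᾱ x)) i → i ∈ word (ᾱ x)
ᾱ-surjective {x} cay rewrite maxT-ᾱ x | word-ᾱ x = cayley-surjective cay

W-range : ∀ {P : ℕ → Set} t → All P (word t) → ∀ i → All P (map label (W t i))
W-range t ps i = Allₚ.map⁺ (All.tabulate λ {v} _ → All.lookup ps (label-∈ v))

-- The sizes agree only propositionally, so the indices have different types and are matched through
-- `toℕ`.
entries-≡ : ∀ {k k′} {A : Vec (Vec ℕ k) k} {A′ : Vec (Vec ℕ k′) k′} →
  _≡_ {A = SquareMatrix} (k , A) (k′ , A′) →
  ∀ {i j i′ j′} → toℕ i ≡ toℕ i′ → toℕ j ≡ toℕ j′ →
  lookup (lookup A i) j ≡ lookup (lookup A′ i′) j′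
entries-≡ {A = A} refl i≡ j≡ =
  cong₂ (λ i j → lookup (lookup A i) j) (toℕ-injective i≡) (toℕ-injective j≡)

lookup-tabulate² : ∀ {k} (f : Fin k → Fin k → ℕ) i j →
  lookup (lookup (tabulate λ i → tabulate (f i)) i) j ≡ f i j
lookup-tabulate² f i j =
  trans (cong (λ v → lookup v j) (lookup∘tabulate _ i)) (lookup∘tabulate (f i) j)

-- Reconciles the reversal of `Fin` indices in matrices with the one-based reversal in covers.
suc-opposite : ∀ {k} (i : Fin k) → suc (toℕ (opposite i)) ≡ k + 1 ∸ suc (toℕ i)
suc-opposite {k} i = begin
  suc (toℕ (opposite i))  ≡⟨ cong suc (opposite-prop i) ⟩
  1 + (k ∸ suc (toℕ i))   ≡⟨ +-∸-assoc 1 (toℕ<n i) ⟨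
  (1 + k) ∸ suc (toℕ i)   ≡⟨ cong (_∸ suc (toℕ i)) (+-comm 1 k) ⟩
  k + 1 ∸ suc (toℕ i)     ∎
  where open ≡-Reasoning

β-flip-count : ∀ {s t} → β s ≡ flipMatrix (β t) → let k = maxT t in
  ∀ {i j} → InRange k i → InRange k j →
  count j (map label (W s i)) ≡ count (k + 1 ∸ i) (map label (W t (k + 1 ∸ j)))
β-flip-count {s} {t} eq {suc i} {suc j} (_ , i<k) (_ , j<k) = begin
  count (suc j) (map label (W s (suc i)))
    ≡⟨ count-map-label (suc j) (W s (suc i)) ⟩
  f s i j
    ≡⟨ cong₂ (f s) (toℕ-fromℕ< i<k′) (toℕ-fromℕ< j<k′) ⟨
  f s (toℕ iₛ) (toℕ jₛ)
    ≡⟨ lookup-tabulate² (λ i j → f s (toℕ i) (toℕ j)) iₛ jₛ ⟨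
  lookup (lookup (proj₂ (β s)) iₛ) jₛ
    ≡⟨ entries-≡ eq (trans (toℕ-fromℕ< i<k′) (sym (toℕ-fromℕ< i<k)))
                    (trans (toℕ-fromℕ< j<k′) (sym (toℕ-fromℕ< j<k))) ⟩
  lookup (lookup (proj₂ (flipMatrix (β t))) iₜ) jₜ
    ≡⟨ lookup-tabulate² (λ i j → lookup (lookup (proj₂ (β t)) (opposite j)) (opposite i)) iₜ jₜ ⟩
  lookup (lookup (proj₂ (β t)) (opposite jₜ)) (opposite iₜ)
    ≡⟨ lookup-tabulate² (λ i j → f t (toℕ i) (toℕ j)) (opposite jₜ) (opposite iₜ) ⟩
  f t (toℕ (opposite jₜ)) (toℕ (opposite iₜ))
    ≡⟨ count-map-label (suc (toℕ (opposite iₜ))) (W t (suc (toℕ (opposite jₜ)))) ⟨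
  count (suc (toℕ (opposite iₜ))) (map label (W t (suc (toℕ (opposite jₜ)))))
    ≡⟨ cong₂ (λ p q → count p (map label (W t q)))
         (trans (suc-opposite iₜ) (cong (λ n → maxT t + 1 ∸ suc n) (toℕ-fromℕ< i<k)))
         (trans (suc-opposite jₜ) (cong (λ n → maxT t + 1 ∸ suc n) (toℕ-fromℕ< j<k))) ⟩
  count (maxT t + 1 ∸ suc i) (map label (W t (maxT t + 1 ∸ suc j))) ∎
  where
  open ≡-Reasoning
  f : BinTree → ℕ → ℕ → ℕ
  f t i j = length (filter (λ v → label v ≟ suc j) (W t (suc i)))
  i<k′ : i < maxT s
  i<k′ = subst (i <_) (sym (cong proj₁ eq)) i<k
  j<k′ : j < maxT s
  j<k′ = subst (j <_) (sym (cong proj₁ eq)) j<k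
  iₛ = fromℕ< i<k′
  jₛ = fromℕ< j<k′
  iₜ = fromℕ< i<k
  jₜ = fromℕ< j<k

flip-block-↭ : ∀ {s t} → let k = maxT t in β s ≡ flipMatrix (β t) →
  All (InRange k) (word s) → All (InRange k) (word t) → ∀ {i} → InRange k i →
  row i (map (flipColumn k) (blockColumns (map label ∘ W t) (interval 0 k))) ↭ map label (W s i)
flip-block-↭ {s} {t} eq rs rt {i} ri = count⇒↭ _ _ same
  where
  k = maxT t
  B = map label ∘ W t
  cols = blockColumns B (interval 0 k)
  cols-range = All-blockColumns B (All-interval {InRange k} 0 k (λ 0<i i≤k → 0<i , i≤k)) (W-range t rt)
  flipped-range : All (InRange k) (row i (map (flipColumn k) cols))
  flipped-range = Allₚ.map⁺ (Allₚ.filter⁺ (λ c → proj₁ c ≟ i)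
    (Allₚ.map⁺ (All.map (complement-range ∘ proj₁) cols-range)))
  same : ∀ j → count j (row i (map (flipColumn k) cols)) ≡ count j (map label (W s i))
  same j with 1 ≤? j ×-dec j ≤? k
  -- The matrices record no label outside the range; both counts vanish there.
  ... | no ¬rj = trans
    (count-∉ (row i (map (flipColumn k) cols)) (¬rj ∘ All.lookup flipped-range))
    (sym (count-∉ (map label (W s i)) (¬rj ∘ All.lookup (W-range s rs i))))
  ... | yes rj = begin
    count j (row i (map (flipColumn k) cols))
      ≡⟨ count-flip cols cols-range ri rj ⟩
    count (k + 1 ∸ i) (row (k + 1 ∸ j) cols)
      ≡⟨ cong (count (k + 1 ∸ i)) (row-blockColumns B 0 k (proj₁ rj′) (proj₂ rj′)) ⟩
    count (k + 1 ∸ i) (B (k + 1 ∸ j))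
      ≡⟨ β-flip-count {s} {t} eq ri rj ⟨
    count j (map label (W s i)) ∎
    where
    open ≡-Reasoning
    rj′ = complement-range rj

mainTheorem6 : (x : Word) → x ≢ [] → IsModifiedAscentSequence x →
    (y : Word) → IsModifiedAscentSequence y →
    β (ᾱ y) ≡ flipMatrix (β (ᾱ x)) →
    y ≡ α (flipCover (𝔓 (ᾱ x)))
mainTheorem6 x _ (cayˣ , _) y masʸ@(cayʸ , _) eq = sym (begin
  α (flipCover (𝔓 (ᾱ x)))
    ≡⟨ cong α (flipCover-blocks (map label ∘ W (ᾱ x)) k) ⟩
  α (map B [1⋯ k ])
    ≡⟨ α-word (ᾱ-decreasing y) (mas-outer masʸ) (All.map proj₂ range) (All.map proj₁ range)
         -- Equal matrices have equal sizes, so `ᾱ y` also has maximum `k`.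
         (λ 1≤i i≤k → ᾱ-surjective cayʸ (1≤i , subst (_ ≤_) (sym (cong proj₁ eq)) i≤k))
         B
         (λ {i} 1≤i i≤k → subst (B i ↭_) (W-labels (ᾱ y) i)
           (flip-block-↭ {ᾱ y} {ᾱ x} eq range (ᾱ-range cayˣ) (1≤i , i≤k))) ⟩
  word (ᾱ y)
    ≡⟨ word-ᾱ y ⟩
  y ∎)
  where
  open ≡-Reasoning
  k = maxT (ᾱ x)
  B : ℕ → Multiset
  B i = row i (map (flipColumn k) (blockColumns (map label ∘ W (ᾱ x)) (interval 0 k)))
  range : All (InRange k) (word (ᾱ y))
  range = subst (λ n → All (InRange n) (word (ᾱ y))) (cong proj₁ eq) (ᾱ-range cayʸ)
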